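{- Let $G$ be a cograph with every connected component of even order. Then $\chi_{\mathsf{odd}}(G) \leq 3$. Moreover, this bound is tight: there exists a cograph $G$ with every connected component of even order such that $\chi_{\mathsf{odd}}(G)=3$.
   Context: All graphs are finite, simple and undirected. A graph is called odd if every vertex has odd degree. $\chi_{\mathsf{odd}}(G)$, the odd chromatic number of $G$, is the minimum number of odd induced subgraphs of $G$ whose vertex sets partition $V(G)$. (By a theorem of Scott, such a partition exists if and only if every connected component of $G$ has even order.) A cograph is a graph with no induced path on four vertices. -}

module Defs where

open import Data.Fin using (Fin; toℕ)
open import Data.Fin.Subset using (Subset; _∈_; _∩_; ∣_∣; Nonempty)
open import Data.Nat using (ℕ; suc; _≤_; _≟_; parity)
open import Data.Nat.Properties using (1+n≢n)
open import Data.Parity using (0ℙ; 1ℙ)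
open import Data.Product using (Σ-syntax; ∃-syntax; _×_)
open import Data.Sum using (_⊎_; inj₁; inj₂; swap)
open import Data.Vec using (tabulate)
open import Function.Bundles using (_⇔_)
open import Function.Definitions using (Injective)
open import Level using (0ℓ)
open import Relation.Binary.Core using (Rel)
open import Relation.Binary.Construct.Closure.ReflexiveTransitive using (Star)
open import Relation.Binary.Definitions using (Decidable; Irreflexive; Symmetric)
open import Relation.Binary.PropositionalEquality using (_≡_; refl)
open import Relation.Nullary using (¬_; does)
open import Relation.Nullary.Decidable using (_⊎-dec_)

record Graph (n : ℕ) : Set₁ where
  infix 4 _~_ _~?_
  field
    _~_      : Rel (Fin n) 0ℓ
    _~?_     : Decidable _~_
    ~-sym    : Symmetric _~_
    ~-irrefl : Irreflexive _≡_ _~_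

  neighbours : Fin n → Subset n
  neighbours v = tabulate (λ w → does (v ~? w))

  -- The degree of v in the subgraph induced by S (meaningful for v ∈ S).
  degreeIn : Subset n → Fin n → ℕ
  degreeIn S v = ∣ neighbours v ∩ S ∣

open Graph using (degreeIn)

path : (n : ℕ) → Graph n
path n = record
  { _~_      = λ i j → suc (toℕ i) ≡ toℕ j ⊎ suc (toℕ j) ≡ toℕ i
  ; _~?_     = λ i j → (suc (toℕ i) ≟ toℕ j) ⊎-dec (suc (toℕ j) ≟ toℕ i)
  ; ~-sym    = swap
  ; ~-irrefl = λ { refl (inj₁ e) → 1+n≢n e ; refl (inj₂ e) → 1+n≢n e }
  }

-- H occurs in G as an induced subgraph, up to isomorphism.
_IsInducedIn_ : ∀ {m n} → Graph m → Graph n → Set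
_IsInducedIn_ {m} {n} H G =
  Σ[ f ∈ (Fin m → Fin n) ]
    Injective _≡_ _≡_ f × (∀ i j → (Graph._~_ H i j) ⇔ (Graph._~_ G (f i) (f j)))

IsCograph : ∀ {n} → Graph n → Set
IsCograph G = ¬ (path 4 IsInducedIn G)

IsComponent : ∀ {n} → Graph n → Subset n → Set
IsComponent G C = ∃[ v ] (∀ w → (w ∈ C) ⇔ Star (Graph._~_ G) v w)

EvenComponents : ∀ {n} → Graph n → Set
EvenComponents G = ∀ C → IsComponent G C → parity ∣ C ∣ ≡ 0ℙ

IsOddInduced : ∀ {n} → Graph n → Subset n → Set
IsOddInduced G S = ∀ v → v ∈ S → parity (degreeIn G S v) ≡ 1ℙ

record OddPartition {n : ℕ} (G : Graph n) (k : ℕ) : Set where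
  field
    part     : Fin k → Subset n
    nonempty : ∀ i → Nonempty (part i)
    disjoint : ∀ i j v → v ∈ part i → v ∈ part j → i ≡ j
    covering : ∀ v → ∃[ i ] v ∈ part i
    odd      : ∀ i → IsOddInduced G (part i)

-- The odd chromatic number as a functional relation, since it is undefined
-- for graphs without an odd partition.
χodd_≡_ : ∀ {n} → Graph n → ℕ → Set
χodd G ≡ k = OddPartition G k × (∀ m → OddPartition G m → k ≤ m)

χodd_≤_ : ∀ {n} → Graph n → ℕ → Set
χodd G ≤ b = ∃[ k ] ((χodd G ≡ k) × (k ≤ b))

{-# OPTIONS --safe #-}

-- Over F₂ the diagonal of a symmetric matrix lies in its image; applied to
-- A + diag(deg + 1) this yields Gallai's theorem that every graph splits into an
-- even and an odd induced subgraph, the odd one having even order.  If G is the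
-- join of two parts of odd order, the union of the two even pieces and the union
-- of the two odd pieces are both odd.  If both parts have even order, first take
-- out one edge across the join as a third class.  A cograph is built from single
-- vertices by disjoint unions and joins; a part closed under adjacency that is a
-- join is a component, hence of even order, and colourings of the parts of a
-- disjoint union combine.  Three classes are needed for K₂₂₂.
module Submission where

open import Defs
open import Algebra.Bundles using (CommutativeRing)
open import Data.Bool using (Bool; true; false; not; _∧_; _∨_; _xor_; if_then_else_)
import Data.Bool as Bool
open import Data.Bool.Properties using (∧-identityʳ; ∨-comm; ∨-zeroʳ; ∧-distribʳ-∨; ∧-zeroʳ; ∧-comm; ∧-assoc)
open import Data.Bool.Properties using (∧-distribˡ-xor; ∧-distribʳ-xor; xor-identityʳ; xor-same; xor-comm)
open import Data.Bool.Properties using (xor-∧-commutativeRing; ¬-not; not-¬; not-involutive)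
open import Algebra.Properties.Semiring.Sum (CommutativeRing.semiring xor-∧-commutativeRing)
  using (sum; sum-cong-≗; ∑-distrib-+; *-distribˡ-sum; sum-replicate-zero)
open import Data.Fin using (Fin; zero; suc; _≟_; punchOut)
open import Data.Fin.Patterns using (0F; 1F; 2F; 3F)
open import Data.Fin.Properties using (any?; all?; punchOut-injective; punchOut-cong)
open import Data.Fin.Subset
  using (Subset; _∈_; _∉_; _⊆_; _⊂_; _-_; _∩_; _∪_; ∁; ⊤; ⁅_⁆; ∣_∣; Nonempty)
open import Data.Fin.Subset.Induction using (Acc; acc; ⊂-wellFounded)
open import Data.Fin.Subset.Properties
open import Data.Nat using (ℕ; zero; suc; _≤_; z≤n; s≤s; parity)
open import Data.Nat.Properties using (1+n≰n; ≤-antisym)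
open import Data.Parity using (Parity; 0ℙ; 1ℙ; _⁻¹)
open import Data.Parity.Properties using (suc-homo-⁻¹; ⁻¹-selfInverse)
open import Data.Product using (Σ-syntax; ∃-syntax; _×_; _,_; proj₁; proj₂)
open import Data.Sum using (_⊎_; inj₁; inj₂; [_,_]′)
open import Data.Vec using (Vec; []; _∷_; lookup; tabulate)
open import Data.Vec.Properties using (lookup∘tabulate; lookup-zipWith; []=⇒lookup; lookup⇒[]=; lookup-replicate)
open import Function using (_∘_)
open import Function.Bundles using (_⇔_; mk⇔; Equivalence)
open import Relation.Binary.Construct.Closure.ReflexiveTransitive using (Star; ε; _◅_)
open import Relation.Binary.PropositionalEquality
  using (_≡_; _≢_; refl; sym; trans; cong; cong₂; subst; module ≡-Reasoning)
open import Relation.Nullary using (Dec; yes; no; does; contradiction; ¬_; ¬?)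
open import Relation.Nullary.Decidable
  using (dec-true; dec-false; does-⇔; _×-dec_; _→-dec_; map′; from-yes; from-no; decidable-stable)

open ≡-Reasoning

private variable
  n k l : ℕ

-- Linear algebra over F₂

δ : Fin n → Fin n → Bool
δ u v = does (u ≟ v)

δ-refl : (v : Fin n) → δ v v ≡ true
δ-refl v = dec-true (v ≟ v) refl

δ-≢ : {u v : Fin n} → u ≢ v → δ u v ≡ false
δ-≢ {u = u} {v} = dec-false (u ≟ v)

-- Symmetry of the diagonal matrix with diagonal `g`; with `g` constantly `true`, that of `δ`
-- itself.
∧-δ-swap : (g : Fin n → Bool) → ∀ u w → g u ∧ δ u w ≡ g w ∧ δ w u
∧-δ-swap g u w with u ≟ w
... | yes refl = cong (g u ∧_) (sym (δ-refl u))
... | no  u≢w  = trans (∧-zeroʳ (g u))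
                       (sym (trans (cong (g w ∧_) (δ-≢ (u≢w ∘ sym))) (∧-zeroʳ (g w))))

sum-false : (f : Fin n → Bool) → (∀ w → f w ≡ false) → sum f ≡ false
sum-false {n} f f≡0 = trans (sum-cong-≗ f≡0) (sum-replicate-zero n)

sum-δ : (f : Fin n → Bool) (v : Fin n) → sum (λ w → f w ∧ δ v w) ≡ f v
sum-δ f zero    = begin
  f zero ∧ true xor sum (λ w → f (suc w) ∧ false)
    ≡⟨ cong₂ _xor_ (∧-identityʳ (f zero)) (sum-false _ (∧-zeroʳ ∘ f ∘ suc)) ⟩
  f zero xor false
    ≡⟨ xor-identityʳ (f zero) ⟩
  f zero ∎
sum-δ f (suc v) = trans (cong (_xor sum (λ w → f (suc w) ∧ δ v w)) (∧-zeroʳ (f zero))) (sum-δ (f ∘ suc) v)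

sum-split : {f g h : Fin n → Bool} → (∀ w → f w ≡ g w xor h w) → sum f ≡ sum g xor sum h
sum-split {g = g} {h} eq = trans (sum-cong-≗ eq) (∑-distrib-+ g h)

-- Over F₂ the entries at `u w` and `w u` cancel. The induction peels off the first row together
-- with the equal first column.
sum-sym-false : (f : Fin n → Fin n → Bool) → (∀ u w → f u w ≡ f w u) → (∀ u → f u u ≡ false) →
                sum (λ u → sum (f u)) ≡ false
sum-sym-false {zero}  f f-sym f-diag = refl
sum-sym-false {suc n} f f-sym f-diag = begin
  (f zero zero xor r) xor sum (λ u → f (suc u) zero xor sum (f (suc u) ∘ suc))
    ≡⟨ cong₂ _xor_ (cong (_xor r) (f-diag zero)) (∑-distrib-+ (λ u → f (suc u) zero) _) ⟩
  r xor (sum (λ u → f (suc u) zero) xor sum (λ u → sum (f (suc u) ∘ suc)))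
    ≡⟨ cong (r xor_) (cong₂ _xor_ (sum-cong-≗ (λ u → f-sym (suc u) zero))
         (sum-sym-false (λ u w → f (suc u) (suc w)) (λ u w → f-sym _ _) (λ u → f-diag _))) ⟩
  r xor (r xor false)
    ≡⟨ cong (r xor_) (xor-identityʳ r) ⟩
  r xor r
    ≡⟨ xor-same r ⟩
  false ∎
  where r = sum (λ w → f zero (suc w))

-- The induction replaces M by its Schur complement at a non-zero diagonal
-- entry v, which kills row v; a solution for the complement is corrected in
-- coordinate v alone.
diagonal-in-image : (M : Fin n → Fin n → Bool) → (∀ u w → M u w ≡ M w u) →
                    ∃[ x ] (∀ u → sum (λ w → M u w ∧ x w) ≡ M u u)
diagonal-in-image M M-sym = go M M-sym ⊤ (⊂-wellFounded ⊤) (λ u u∉⊤ → contradiction ∈⊤ u∉⊤)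
  where
  -- Since `q ∧ q` is `q`, moving it to the left turns the factor `r` into `not r`; hence the
  -- correction `not (s v)` at the pivot.
  pivot : ∀ p q r d → p xor (q ∧ r) ≡ d xor (q ∧ q) → p xor (not r ∧ q) ≡ d
  pivot p     false r     d     eq rewrite ∧-zeroʳ (not r) = trans eq (xor-identityʳ d)
  pivot false true  false false ()
  pivot false true  false true  eq = refl
  pivot false true  true  false eq = refl
  pivot false true  true  true  ()
  pivot true  true  false false eq = refl
  pivot true  true  false true  ()
  pivot true  true  true  false ()
  pivot true  true  true  true  eq = refl

  row : ∀ a b c x → (a xor (b ∧ c)) ∧ x ≡ (a ∧ x) xor (b ∧ (c ∧ x))
  row a b c x = trans (∧-distribʳ-xor x a (b ∧ c)) (cong ((a ∧ x) xor_) (∧-assoc b c x))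

  entry : ∀ m x c e → m ∧ (x xor (c ∧ e)) ≡ (m ∧ x) xor ((c ∧ m) ∧ e)
  entry m x c e = begin
    m ∧ (x xor (c ∧ e))         ≡⟨ ∧-distribˡ-xor m x (c ∧ e) ⟩
    (m ∧ x) xor (m ∧ (c ∧ e))   ≡⟨ cong ((m ∧ x) xor_) (∧-assoc m c e) ⟨
    (m ∧ x) xor ((m ∧ c) ∧ e)   ≡⟨ cong (λ t → (m ∧ x) xor (t ∧ e)) (∧-comm m c) ⟩
    (m ∧ x) xor ((c ∧ m) ∧ e)   ∎

  -- `Z` contains every row not yet known to vanish. Each pivot `v` leaves it, so the recursion
  -- ends, at the latest with a zero matrix.
  go : (M : Fin n → Fin n → Bool) → (∀ u w → M u w ≡ M w u) →
       (Z : Subset n) → Acc _⊂_ Z → (∀ u → u ∉ Z → ∀ w → M u w ≡ false) →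
       ∃[ x ] (∀ u → sum (λ w → M u w ∧ x w) ≡ M u u)
  go M M-sym Z (acc rec) zero-row with any? (λ v → M v v Bool.≟ true)
  ... | no  ∄v      = (λ _ → false) , λ u → trans (sum-false _ (λ w → ∧-zeroʳ (M u w)))
                                                  (sym (¬-not (λ e → ∄v (u , e))))
  ... | yes (v , Mvv) = x , solves
    where
    v∈Z : v ∈ Z
    v∈Z with v ∈? Z
    ... | yes v∈Z = v∈Z
    ... | no  v∉Z = contradiction (trans (sym Mvv) (zero-row v v∉Z v)) λ ()

    M′ : Fin _ → Fin _ → Bool
    M′ u w = M u w xor (M u v ∧ M v w)

    M′-sym : ∀ u w → M′ u w ≡ M′ w u
    M′-sym u w = cong₂ _xor_ (M-sym u w)
      (trans (∧-comm (M u v) (M v w)) (cong₂ _∧_ (M-sym v w) (M-sym u v)))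

    zero-row′ : ∀ u → u ∉ Z - v → ∀ w → M′ u w ≡ false
    zero-row′ u u∉Z-v w with u ≟ v | u ∈? Z
    ... | yes refl | _       rewrite Mvv = xor-same (M v w)
    ... | no  u≢v  | yes u∈Z = contradiction (x∈p∧x≢y⇒x∈p-y u∈Z u≢v) u∉Z-v
    ... | no  u≢v  | no u∉Z  rewrite zero-row u u∉Z w | zero-row u u∉Z v = refl

    IH = go M′ M′-sym (Z - v) (rec (x∈p⇒p-x⊂p v∈Z)) zero-row′
    x′ = proj₁ IH
    s : Fin _ → Bool
    s u = sum (λ w → M u w ∧ x′ w)

    x : Fin _ → Bool
    x w = x′ w xor (not (s v) ∧ δ v w)

    M′x′ : ∀ u → s u xor (M u v ∧ s v) ≡ M u u xor (M u v ∧ M u v)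
    M′x′ u = begin
      s u xor (M u v ∧ s v)
        ≡⟨ cong (s u xor_) (*-distribˡ-sum (M u v) (λ w → M v w ∧ x′ w)) ⟩
      s u xor sum (λ w → M u v ∧ (M v w ∧ x′ w))
        ≡⟨ sum-split (λ w → row (M u w) (M u v) (M v w) (x′ w)) ⟨
      sum (λ w → M′ u w ∧ x′ w)
        ≡⟨ proj₂ IH u ⟩
      M u u xor (M u v ∧ M v u)
        ≡⟨ cong (λ t → M u u xor (M u v ∧ t)) (M-sym v u) ⟩
      M u u xor (M u v ∧ M u v) ∎

    solves : ∀ u → sum (λ w → M u w ∧ x w) ≡ M u u
    solves u = begin
      sum (λ w → M u w ∧ x w)
        ≡⟨ sum-split (λ w → entry (M u w) (x′ w) (not (s v)) (δ v w)) ⟩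
      s u xor sum (λ w → (not (s v) ∧ M u w) ∧ δ v w)
        ≡⟨ cong (s u xor_) (sum-δ (λ w → not (s v) ∧ M u w) v) ⟩
      s u xor (not (s v) ∧ M u v)
        ≡⟨ pivot (s u) (M u v) (s v) (M u u) (M′x′ u) ⟩
      M u u ∎

infix 5 _==_
-- Equality written as a sum over F₂, so that the condition `x w == c` can be expanded linearly
-- under `sum`.
_==_ : Bool → Bool → Bool
x == y = x xor not y

==-refl : ∀ x → x == x ≡ true
==-refl false = refl
==-refl true  = refl

∨-true : ∀ {a b} → a ∨ b ≡ true → a ≡ true ⊎ b ≡ true
∨-true {true}  _ = inj₁ refl
∨-true {false} e = inj₂ e

disjoint-sym : ∀ {a b} → (a ≡ true → b ≡ false) → b ≡ true → a ≡ false
disjoint-sym {false} _ _ = refl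
disjoint-sym {true} disjoint refl = disjoint refl

disjoint⇒∨≡xor : ∀ {a b} → (a ≡ true → b ≡ false) → a ∨ b ≡ a xor b
disjoint⇒∨≡xor {false} _ = refl
disjoint⇒∨≡xor {true} disjoint = sym (cong not (disjoint refl))

sum-disjoint : {S A B : Fin n → Bool} → (∀ w → S w ≡ A w ∨ B w) → (∀ w → A w ≡ true → B w ≡ false) →
               sum S ≡ sum A xor sum B
sum-disjoint S≡A∨B disjoint = sum-split (λ w → trans (S≡A∨B w) (disjoint⇒∨≡xor (disjoint w)))

-- Odd colourings

module Colouring (a : Fin n → Fin n → Bool)
                 (a-sym : ∀ u w → a u w ≡ a w u) (a-irrefl : ∀ u → a u u ≡ false) where

  -- `sum` adds with `xor`, so this is the number of neighbours in `S` modulo 2. Throughout this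
  -- module orders and degrees are tracked only modulo 2.
  degree : (Fin n → Bool) → Fin n → Bool
  degree S v = sum (λ w → a v w ∧ S w)

  Odd : (Fin n → Bool) → Set
  Odd S = ∀ v → S v ≡ true → degree S v ≡ true

  -- As all degrees are odd, the order has the parity of the degree sum, which is the sum of all
  -- entries of a symmetric matrix with zero diagonal.
  handshake : ∀ S → Odd S → sum S ≡ false
  handshake S odd = begin
    sum S                                        ≡⟨ sum-cong-≗ pointwise ⟩
    sum (λ v → sum (λ w → S v ∧ (a v w ∧ S w)))  ≡⟨ sum-sym-false _ swap-ends diag ⟩
    false                                        ∎
    where
    pointwise : ∀ v → S v ≡ sum (λ w → S v ∧ (a v w ∧ S w))
    pointwise v with S v in eq
    ... | true  = sym (odd v eq)
    ... | false = sym (sum-false {n} _ (λ _ → refl))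
    swap-ends : ∀ u w → S u ∧ (a u w ∧ S w) ≡ S w ∧ (a w u ∧ S u)
    swap-ends u w rewrite a-sym u w with S u | S w
    ... | false | false = refl
    ... | false | true  = sym (∧-zeroʳ (a w u))
    ... | true  | false = ∧-zeroʳ (a w u)
    ... | true  | true  = refl
    diag : ∀ u → S u ∧ (a u u ∧ S u) ≡ false
    diag u rewrite a-irrefl u = ∧-zeroʳ (S u)

  -- x splits S into an even induced subgraph (x = true) and an odd one (x = false).
  EvenOdd : (S x : Fin n → Bool) → Set
  EvenOdd S x = ∀ v → S v ≡ true → degree (λ w → S w ∧ (x w == x v)) v ≡ not (x v)

  evenOdd : ∀ S → ∃[ x ] EvenOdd S x
  evenOdd S = x , splits
    where
    d : Fin n → Bool
    d = degree S
    -- The adjacency matrix of the subgraph induced by `S`, plus the diagonal matrix of degrees plus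
    -- one, extended by zero outside `S`.
    M : Fin n → Fin n → Bool
    M u w = (S u ∧ (S w ∧ a u w)) xor ((S u ∧ not (d u)) ∧ δ u w)
    M-sym : ∀ u w → M u w ≡ M w u
    M-sym u w = cong₂ _xor_ pointwise (∧-δ-swap (λ u → S u ∧ not (d u)) u w)
      where
      pointwise : S u ∧ (S w ∧ a u w) ≡ S w ∧ (S u ∧ a w u)
      pointwise rewrite a-sym u w with S u | S w
      ... | false | false = refl
      ... | false | true  = refl
      ... | true  | false = refl
      ... | true  | true  = refl
    solution = diagonal-in-image M M-sym
    x = proj₁ solution
    M-diag : ∀ v → S v ≡ true → M v v ≡ not (d v)
    M-diag v Sv rewrite Sv | a-irrefl v | δ-refl v = ∧-identityʳ _
    e : Fin n → Bool
    e = degree (λ w → S w ∧ x w)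
    row : ∀ v → S v ≡ true → e v xor (not (d v) ∧ x v) ≡ not (d v)
    row v Sv = begin
      e v xor (not (d v) ∧ x v)
        ≡⟨ cong (e v xor_) (sum-δ (λ w → not (d v) ∧ x w) v) ⟨
      e v xor sum (λ w → (not (d v) ∧ x w) ∧ δ v w)
        ≡⟨ sum-split pointwise ⟨
      sum (λ w → M v w ∧ x w)
        ≡⟨ proj₂ solution v ⟩
      M v v
        ≡⟨ M-diag v Sv ⟩
      not (d v) ∎
      where
      pointwise : ∀ w → M v w ∧ x w ≡ (a v w ∧ (S w ∧ x w)) xor ((not (d v) ∧ x w) ∧ δ v w)
      pointwise w rewrite Sv = expand (S w) (a v w) (x w) (not (d v)) (δ v w)
        where
        expand : ∀ s t y c e → ((s ∧ t) xor (c ∧ e)) ∧ y ≡ (t ∧ (s ∧ y)) xor ((c ∧ y) ∧ e)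
        expand s t false c e
          rewrite ∧-zeroʳ ((s ∧ t) xor (c ∧ e)) | ∧-zeroʳ s | ∧-zeroʳ t | ∧-zeroʳ c = refl
        expand s t true  c e
          rewrite ∧-identityʳ ((s ∧ t) xor (c ∧ e)) | ∧-identityʳ s | ∧-identityʳ c | ∧-comm s t = refl
    -- Here `e` is the degree into the class `x = true` and `d` the degree into `S`. For `x` true
    -- the row equation gives `e = 0`; for `x` false it gives `e = d + 1`, so the degree into the
    -- other class is `d + e = 1`.
    combine : ∀ e d x → e xor (not d ∧ x) ≡ not d → e xor (not x ∧ d) ≡ not x
    combine false false false ()
    combine false false true  _ = refl
    combine false true  false _ = refl
    combine false true  true  _ = refl
    combine true  false false _ = refl
    combine true  false true  ()
    combine true  true  false ()
    combine true  true  true  ()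
    splits : EvenOdd S x
    splits v Sv = begin
      degree (λ w → S w ∧ (x w == x v)) v
        ≡⟨ sum-split (λ w → pointwise (a v w) (S w) (x w) (not (x v))) ⟩
      e v xor sum (λ w → not (x v) ∧ (a v w ∧ S w))
        ≡⟨ cong (e v xor_) (*-distribˡ-sum (not (x v)) (λ w → a v w ∧ S w)) ⟨
      e v xor (not (x v) ∧ d v)
        ≡⟨ combine (e v) (d v) (x v) (row v Sv) ⟩
      not (x v) ∎
      where
      pointwise : ∀ a s x y → a ∧ (s ∧ (x xor y)) ≡ (a ∧ (s ∧ x)) xor (y ∧ (a ∧ s))
      pointwise false s     x y = sym (∧-zeroʳ y)
      pointwise true  false x y = sym (∧-zeroʳ y)
      pointwise true  true  x y = cong (x xor_) (sym (∧-identityʳ y))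

  OddColouring : (S : Fin n → Bool) → (Fin n → Fin k) → Set
  OddColouring S f = ∀ v → S v ≡ true → degree (λ w → S w ∧ δ (f w) (f v)) v ≡ true

  OddColouring-cong : ∀ {S : Fin n → Bool} {f g : Fin n → Fin k} → (∀ w → S w ≡ true → f w ≡ g w) →
                      OddColouring S f → OddColouring S g
  OddColouring-cong {S = S} {f} {g} f≡g odd v Sv =
    trans (sum-cong-≗ (λ w → cong (a v w ∧_) (same w))) (odd v Sv)
    where
    same : ∀ w → S w ∧ δ (g w) (g v) ≡ S w ∧ δ (f w) (f v)
    same w with S w in Sw
    ... | true  = cong₂ δ (sym (f≡g w Sw)) (sym (f≡g v Sv))
    ... | false = refl

  -- No edge between `A` and `B` is monochromatic, so adding `B` does not change degrees inside the
  -- colour classes of `A`. This applies to disjoint unions, where there are no such edges, and to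
  -- an edge taken out with a fresh colour.
  union-side : ∀ {S A B : Fin n → Bool} {f : Fin n → Fin k} → (∀ w → S w ≡ A w ∨ B w) → OddColouring A f →
               (∀ u w → A u ≡ true → B w ≡ true → a u w ∧ δ (f w) (f u) ≡ false) →
               ∀ v → A v ≡ true → degree (λ w → S w ∧ δ (f w) (f v)) v ≡ true
  union-side {S = S} {A} {B} {f} S≡A∨B odd-A sep v Av = trans (sum-cong-≗ same) (odd-A v Av)
    where
    same : ∀ w → a v w ∧ (S w ∧ δ (f w) (f v)) ≡ a v w ∧ (A w ∧ δ (f w) (f v))
    same w rewrite S≡A∨B w with A w | B w in Bw
    ... | true  | _     = refl
    ... | false | true  = trans (sep v w Av Bw) (sym (∧-zeroʳ (a v w)))
    ... | false | false = refl

  union-colouring : ∀ {S A B : Fin n → Bool} {f : Fin n → Fin k} → (∀ w → S w ≡ A w ∨ B w) →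
                    OddColouring A f → OddColouring B f →
                    (∀ u w → A u ≡ true → B w ≡ true → a u w ∧ δ (f w) (f u) ≡ false) →
                    OddColouring S f
  union-colouring {A = A} {B} {f} S≡A∨B odd-A odd-B sep v Sv with ∨-true (trans (sym (S≡A∨B v)) Sv)
  ... | inj₁ Av = union-side {f = f} S≡A∨B odd-A sep v Av
  ... | inj₂ Bv = union-side {f = f} (λ w → trans (S≡A∨B w) (∨-comm (A w) (B w))) odd-B sep′ v Bv
    where
    sep′ : ∀ u w → B u ≡ true → A w ≡ true → a u w ∧ δ (f w) (f u) ≡ false
    sep′ u w Bu Aw = trans (cong₂ _∧_ (a-sym u w) (∧-δ-swap (λ _ → true) (f w) (f u))) (sep w u Aw Bu)

  EvenOdd-cong : ∀ {S x y : Fin n → Bool} → (∀ w → S w ≡ true → x w ≡ y w) → EvenOdd S x → EvenOdd S y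
  EvenOdd-cong {S} {x} {y} x≡y split v Sv = begin
    degree (λ w → S w ∧ (y w == y v)) v  ≡⟨ sum-cong-≗ (λ w → cong (a v w ∧_) (same w)) ⟩
    degree (λ w → S w ∧ (x w == x v)) v  ≡⟨ split v Sv ⟩
    not (x v)                            ≡⟨ cong not (x≡y v Sv) ⟩
    not (y v)                            ∎
    where
    same : ∀ w → S w ∧ (y w == y v) ≡ S w ∧ (x w == x v)
    same w with S w in Sw
    ... | true  = cong₂ _==_ (sym (x≡y w Sw)) (sym (x≡y v Sv))
    ... | false = refl

  -- The odd part has even order by the handshake lemma.
  class-size : ∀ {S x : Fin n → Bool} → EvenOdd S x → sum S ≡ true → ∀ c → sum (λ w → S w ∧ (x w == c)) ≡ c
  class-size {S} {x} split S-odd false = handshake _ odd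
    where
    odd : Odd (λ w → S w ∧ (x w == false))
    odd v v∈O with S v in Sv | x v in xv
    ... | true | false = trans (sum-cong-≗ (λ w → cong (λ c → a v w ∧ (S w ∧ (x w == c))) (sym xv)))
                               (trans (split v Sv) (cong not xv))
  class-size {S} {x} split S-odd true = begin
    sum E                 ≡⟨ xor-identityʳ (sum E) ⟨
    sum E xor false       ≡⟨ cong (sum E xor_) (class-size {S} {x} split S-odd false) ⟨
    sum E xor sum O       ≡⟨ sum-split (λ w → pointwise (S w) (x w)) ⟨
    sum S                 ≡⟨ S-odd ⟩
    true                  ∎
    where
    E O : Fin n → Bool
    E w = S w ∧ (x w == true)
    O w = S w ∧ (x w == false)
    pointwise : ∀ s x → s ≡ (s ∧ (x == true)) xor (s ∧ (x == false))
    pointwise false x     = refl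
    pointwise true  false = refl
    pointwise true  true  = refl

  -- Within its own piece of `A`, `v` has degree `not (x v)`. It also sees the whole piece of `B`
  -- with the same label, whose order is `x v` modulo 2. The two add up to one.
  join-side : ∀ {S A B x : Fin n → Bool} → (∀ w → S w ≡ A w ∨ B w) → (∀ w → A w ≡ true → B w ≡ false) →
              (∀ u w → A u ≡ true → B w ≡ true → a u w ≡ true) →
              EvenOdd A x → EvenOdd B x → sum B ≡ true →
              ∀ v → A v ≡ true → degree (λ w → S w ∧ (x w == x v)) v ≡ true
  join-side {S} {A} {B} {x} S≡A∨B disjoint complete split-A split-B B-odd v Av = begin
    degree (λ w → S w ∧ (x w == x v)) v
      ≡⟨ sum-split pointwise ⟩
    degree (λ w → A w ∧ (x w == x v)) v xor sum (λ w → B w ∧ (x w == x v))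
      ≡⟨ cong₂ _xor_ (split-A v Av) (class-size {B} {x} split-B B-odd (x v)) ⟩
    not (x v) xor x v
      ≡⟨ xor-comm (not (x v)) (x v) ⟩
    x v == x v
      ≡⟨ ==-refl (x v) ⟩
    true ∎
    where
    pointwise : ∀ w → a v w ∧ (S w ∧ (x w == x v)) ≡ (a v w ∧ (A w ∧ (x w == x v))) xor (B w ∧ (x w == x v))
    pointwise w rewrite S≡A∨B w with A w in Aw | B w in Bw
    ... | true  | true  = contradiction (trans (sym Bw) (disjoint w Aw)) λ ()
    ... | true  | false = sym (xor-identityʳ _)
    ... | false | true  rewrite complete v w Av Bw = refl
    ... | false | false rewrite ∧-zeroʳ (a v w) = refl

  OddColourable₃ : (Fin n → Bool) → Set
  OddColourable₃ S = ∃[ f ] OddColouring {3} S f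

  twoColours : Bool → Fin 3
  twoColours false = 0F
  twoColours true  = 1F

  δ-twoColours : ∀ x y → δ (twoColours x) (twoColours y) ≡ (x == y)
  δ-twoColours false false = refl
  δ-twoColours false true  = refl
  δ-twoColours true  false = refl
  δ-twoColours true  true  = refl

  -- The Gallai splits of `A` and `B` are merged label by label. The colouring is returned as
  -- `twoColours ∘ x` to keep `2F` free for a third class.
  join-odd-odd : ∀ {S A B : Fin n → Bool} → (∀ w → S w ≡ A w ∨ B w) → (∀ w → A w ≡ true → B w ≡ false) →
                 (∀ u w → A u ≡ true → B w ≡ true → a u w ≡ true) →
                 sum A ≡ true → sum B ≡ true → ∃[ x ] OddColouring S (twoColours ∘ x)
  join-odd-odd {S} {A} {B} S≡A∨B disjoint complete A-odd B-odd = x , odd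
    where
    xA = proj₁ (evenOdd A)
    xB = proj₁ (evenOdd B)
    x : Fin n → Bool
    x w = if A w then xA w else xB w
    split-A : EvenOdd A x
    split-A = EvenOdd-cong (λ w Aw → cong (if_then xA w else xB w) (sym Aw)) (proj₂ (evenOdd A))
    split-B : EvenOdd B x
    split-B = EvenOdd-cong (λ w Bw → cong (if_then xA w else xB w) (sym (disjoint-sym (disjoint w) Bw)))
                           (proj₂ (evenOdd B))
    odd-x : ∀ v → S v ≡ true → degree (λ w → S w ∧ (x w == x v)) v ≡ true
    odd-x v Sv with ∨-true (trans (sym (S≡A∨B v)) Sv)
    ... | inj₁ Av = join-side {x = x} S≡A∨B disjoint complete split-A split-B B-odd v Av
    ... | inj₂ Bv = join-side {x = x} (λ w → trans (S≡A∨B w) (∨-comm (A w) (B w))) (disjoint-sym ∘ disjoint)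
                      (λ u w Bu Aw → trans (a-sym u w) (complete w u Aw Bu)) split-B split-A A-odd v Bv
    odd : OddColouring S (twoColours ∘ x)
    odd v Sv = trans (sum-cong-≗ (λ w → cong (λ c → a v w ∧ (S w ∧ c)) (δ-twoColours (x w) (x v)))) (odd-x v Sv)

  edge-colouring : ∀ {p q} → a p q ≡ true → (c : Fin k) → OddColouring (λ w → δ p w ∨ δ q w) (λ _ → c)
  edge-colouring {p = p} {q} apq c v v∈P = trans (sum-split pointwise)
    (trans (cong₂ _xor_ (sum-δ (a v) p) (sum-δ (a v) q)) (ends v∈P))
    where
    pointwise : ∀ w → a v w ∧ ((δ p w ∨ δ q w) ∧ δ c c) ≡ (a v w ∧ δ p w) xor (a v w ∧ δ q w)
    pointwise w rewrite δ-refl c | ∧-identityʳ (δ p w ∨ δ q w) with p ≟ w | q ≟ w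
    ... | yes refl | yes refl = contradiction (trans (sym apq) (a-irrefl p)) λ ()
    ... | yes _    | no _     rewrite ∧-zeroʳ (a v w) = sym (xor-identityʳ _)
    ... | no _     | r        rewrite ∧-zeroʳ (a v w) = refl
    ends : δ p v ∨ δ q v ≡ true → a v p xor a v q ≡ true
    ends _ with p ≟ v | q ≟ v
    ends _  | yes refl | _        rewrite a-irrefl p = apq
    ends _  | no _     | yes refl rewrite a-irrefl q | a-sym q p | apq = refl
    ends () | no _     | no _

  -- The edge from `p` to `q` becomes the class `2F`. What remains is a join of two parts of odd
  -- order, coloured with `0F` and `1F`.
  join-even-even : ∀ {S A B : Fin n → Bool} → (∀ w → S w ≡ A w ∨ B w) → (∀ w → A w ≡ true → B w ≡ false) →
                   (∀ u w → A u ≡ true → B w ≡ true → a u w ≡ true) →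
                   sum A ≡ false → sum B ≡ false → ∀ {p q} → A p ≡ true → B q ≡ true → OddColourable₃ S
  join-even-even {S} {A} {B} S≡A∨B disjoint complete A-even B-even {p} {q} Ap Bq =
    f , union-colouring {f = f} S≡S′∨P
          (OddColouring-cong (λ w S′w → sym (f-S′ w S′w)) odd-S′)
          (OddColouring-cong (λ w Pw → sym (f-P w Pw)) (edge-colouring {k = 3} (complete p q Ap Bq) 2F))
          separated
    where
    P S′ A′ B′ : Fin n → Bool
    P w = δ p w ∨ δ q w
    S′ w = S w ∧ not (P w)
    A′ w = A w ∧ not (P w)
    B′ w = B w ∧ not (P w)
    Aq : A q ≡ false
    Aq = disjoint-sym (disjoint q) Bq
    S≡S′∨P : ∀ w → S w ≡ S′ w ∨ P w
    S≡S′∨P w with p ≟ w | q ≟ w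
    ... | yes refl | _        rewrite S≡A∨B p | Ap = refl
    ... | no _     | yes refl rewrite S≡A∨B q | Bq | ∨-zeroʳ (A q) = refl
    ... | no _     | no _     rewrite ∧-identityʳ (S w) = ∨-comm false (S w)
    S′≡A′∨B′ : ∀ w → S′ w ≡ A′ w ∨ B′ w
    S′≡A′∨B′ w = trans (cong (_∧ not (P w)) (S≡A∨B w)) (∧-distribʳ-∨ (not (P w)) (A w) (B w))
    -- Deleting one vertex from each side makes both orders odd.
    remove : ∀ C r → (∀ w → C w ≡ (C w ∧ not (P w)) xor δ r w) → sum C ≡ false →
             sum (λ w → C w ∧ not (P w)) ≡ true
    remove C r eq C-even = flip (trans (sym C-even) (trans (sum-split eq)
      (cong (sum (λ w → C w ∧ not (P w)) xor_) (sum-δ (λ _ → true) r))))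
      where
      flip : ∀ {b} → false ≡ b xor true → b ≡ true
      flip {true} _ = refl
    A′-odd : sum A′ ≡ true
    A′-odd = remove A p pointwise A-even
      where
      pointwise : ∀ w → A w ≡ A′ w xor δ p w
      pointwise w with p ≟ w | q ≟ w
      ... | yes refl | _        rewrite Ap = refl
      ... | no _     | yes refl rewrite Aq = refl
      ... | no _     | no _     rewrite ∧-identityʳ (A w) = sym (xor-identityʳ (A w))
    B′-odd : sum B′ ≡ true
    B′-odd = remove B q pointwise B-even
      where
      pointwise : ∀ w → B w ≡ B′ w xor δ q w
      pointwise w with p ≟ w | q ≟ w
      ... | yes refl | yes refl = contradiction (trans (sym Bq) (disjoint p Ap)) λ ()
      ... | yes refl | no _     rewrite disjoint p Ap = refl
      ... | no _     | yes refl rewrite Bq = refl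
      ... | no _     | no _     rewrite ∧-identityʳ (B w) = sym (xor-identityʳ (B w))
    ⊆ : ∀ {C : Fin n → Bool} w → C w ∧ not (P w) ≡ true → C w ≡ true
    ⊆ {C} w e with C w
    ... | true = refl
    disjoint′ : ∀ w → A′ w ≡ true → B′ w ≡ false
    disjoint′ w A′w = cong (_∧ not (P w)) (disjoint w (⊆ {A} w A′w))
    coloured = join-odd-odd S′≡A′∨B′ disjoint′
      (λ u w A′u B′w → complete u w (⊆ {A} u A′u) (⊆ {B} w B′w)) A′-odd B′-odd
    x = proj₁ coloured
    odd-S′ : OddColouring S′ (twoColours ∘ x)
    odd-S′ = proj₂ coloured
    f : Fin n → Fin 3
    f w = if P w then 2F else twoColours (x w)
    S′⇒¬P : ∀ w → S′ w ≡ true → P w ≡ false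
    S′⇒¬P w e with S w | P w
    ... | true | false = refl
    f-S′ : ∀ w → S′ w ≡ true → f w ≡ twoColours (x w)
    f-S′ w S′w = cong (if_then 2F else twoColours (x w)) (S′⇒¬P w S′w)
    f-P : ∀ w → P w ≡ true → f w ≡ 2F
    f-P w = cong (if_then 2F else twoColours (x w))
    twoColours≢2 : ∀ b → δ 2F (twoColours b) ≡ false
    twoColours≢2 false = refl
    twoColours≢2 true  = refl
    separated : ∀ u w → S′ u ≡ true → P w ≡ true → a u w ∧ δ (f w) (f u) ≡ false
    separated u w S′u Pw = trans (cong (a u w ∧_) (trans (cong₂ δ (f-P w Pw) (f-S′ u S′u)) (twoColours≢2 (x u))))
                                 (∧-zeroʳ (a u w))

  -- Since `S` has even order, the orders of `A` and `B` have equal parity.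
  join-colouring : ∀ {S A B : Fin n → Bool} → (∀ w → S w ≡ A w ∨ B w) → (∀ w → A w ≡ true → B w ≡ false) →
                   (∀ u w → A u ≡ true → B w ≡ true → a u w ≡ true) →
                   ∀ {p q} → A p ≡ true → B q ≡ true → sum S ≡ false → OddColourable₃ S
  join-colouring {S} {A} {B} S≡A∨B disjoint complete Ap Bq S-even with sum A in sA | sum B in sB
  ... | true  | true  = let x , odd = join-odd-odd S≡A∨B disjoint complete sA sB in twoColours ∘ x , odd
  ... | false | false = join-even-even S≡A∨B disjoint complete sA sB Ap Bq
  ... | true  | false = contradiction (trans (sym S-even) (trans (sum-disjoint S≡A∨B disjoint) (cong₂ _xor_ sA sB))) λ ()
  ... | false | true  = contradiction (trans (sym S-even) (trans (sum-disjoint S≡A∨B disjoint) (cong₂ _xor_ sA sB))) λ ()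

  -- The same three colours serve both parts, because no edge runs between them.
  disjoint-union-colouring : ∀ {S A B : Fin n → Bool} → (∀ w → S w ≡ A w ∨ B w) → (∀ w → A w ≡ true → B w ≡ false) →
                             (∀ u w → A u ≡ true → B w ≡ true → a u w ≡ false) →
                             OddColourable₃ A → OddColourable₃ B → OddColourable₃ S
  disjoint-union-colouring {A = A} {B} S≡A∨B disjoint separated (f , odd-f) (g , odd-g) =
    h , union-colouring {f = h} S≡A∨B
          (OddColouring-cong (λ w Aw → cong (if_then f w else g w) (sym Aw)) odd-f)
          (OddColouring-cong (λ w Bw → cong (if_then f w else g w) (sym (disjoint-sym (disjoint w) Bw))) odd-g)
          (λ u w Au Bw → cong (_∧ δ (h w) (h u)) (separated u w Au Bw))
    where
    h : Fin n → Fin 3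
    h w = if A w then f w else g w

-- Cotrees

does-true : {P : Set} (P? : Dec P) → does P? ≡ true → P
does-true (yes p) _ = p

does≡⇒⇔ : {P Q : Set} (P? : Dec P) (Q? : Dec Q) → does P? ≡ does Q? → P ⇔ Q
does≡⇒⇔ P? Q? eq = mk⇔ (λ p → does-true Q? (trans (sym eq) (dec-true P? p)))
                       (λ q → does-true P? (trans eq (dec-true Q? q)))

module Adjacency (G : Graph n) where
  open Graph G

  adj : Fin n → Fin n → Bool
  adj u w = does (u ~? w)

  adj-sym : ∀ u w → adj u w ≡ adj w u
  adj-sym u w = does-⇔ (mk⇔ ~-sym ~-sym) (u ~? w) (w ~? u)

  adj-irrefl : ∀ u → adj u u ≡ false
  adj-irrefl u = dec-false (u ~? u) (~-irrefl refl)

  open Colouring adj adj-sym adj-irrefl public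

-- Distinct vertices of P₄ have distinct neighbourhoods, so a map preserving
-- and reflecting adjacency is injective.
path₄-twin-free : ∀ i j → (∀ m → Adjacency.adj (path 4) i m ≡ Adjacency.adj (path 4) j m) → i ≡ j
path₄-twin-free = from-yes (all? λ i → all? λ j →
  all? (λ m → Adjacency.adj (path 4) i m Bool.≟ Adjacency.adj (path 4) j m) →-dec (i ≟ j))

module _ (G : Graph n) where
  open Graph G
  open Adjacency G

  path₄-induced : ∀ {y x v z} → adj y x ≡ true → adj x v ≡ true → adj v z ≡ true →
                  adj y v ≡ false → adj x z ≡ false → adj y z ≡ false → path 4 IsInducedIn G
  path₄-induced {y} {x} {v} {z} yx xv vz yv xz yz =
    f , injective , λ i j → does≡⇒⇔ (Graph._~?_ (path 4) i j) (f i ~? f j) (preserves i j)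
    where
    f : Fin 4 → Fin n
    f = lookup (y ∷ x ∷ v ∷ z ∷ [])
    flip : ∀ {u w b} → adj u w ≡ b → b ≡ adj w u
    flip {u} {w} e = trans (sym e) (adj-sym u w)
    preserves : ∀ i j → Adjacency.adj (path 4) i j ≡ adj (f i) (f j)
    preserves 0F 0F = sym (adj-irrefl y)
    preserves 0F 1F = sym yx
    preserves 0F 2F = sym yv
    preserves 0F 3F = sym yz
    preserves 1F 0F = flip yx
    preserves 1F 1F = sym (adj-irrefl x)
    preserves 1F 2F = sym xv
    preserves 1F 3F = sym xz
    preserves 2F 0F = flip yv
    preserves 2F 1F = flip xv
    preserves 2F 2F = sym (adj-irrefl v)
    preserves 2F 3F = sym vz
    preserves 3F 0F = flip yz
    preserves 3F 1F = flip xz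
    preserves 3F 2F = flip vz
    preserves 3F 3F = sym (adj-irrefl z)
    injective : ∀ {i j} → f i ≡ f j → i ≡ j
    injective {i} {j} fi≡fj = path₄-twin-free i j (λ m →
      trans (preserves i m) (trans (cong (λ u → adj u (f m)) fi≡fj) (sym (preserves j m))))

  -- P₄ is self-complementary: the complement of y x v z is the path x z y v.
  path₄-free : IsCograph G → ∀ b {y x v z} → adj y x ≡ b → adj x v ≡ b → adj v z ≡ b →
               adj y v ≡ not b → adj x z ≡ not b → ¬ (adj y z ≡ not b)
  path₄-free cograph true  yx xv vz yv xz yz = cograph (path₄-induced yx xv vz yv xz yz)
  path₄-free cograph false {y} {x} {v} {z} yx xv vz yv xz yz =
    cograph (path₄-induced xz (trans (adj-sym z y) yz) yv (trans (adj-sym x y) yx) (trans (adj-sym z v) vz) xv)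

  -- A `true` node is a join and a `false` node a disjoint union; nested nodes may repeat a label.
  -- Keeping the label a variable lets one argument treat a graph and its complement together.
  data Cotree : Subset n → Set where
    leaf : ∀ v → Cotree ⁅ v ⁆
    node : ∀ {A B} b → (∀ {w} → w ∈ A → w ∉ B) → (∀ {u w} → u ∈ A → w ∈ B → adj u w ≡ b) →
           Cotree A → Cotree B → Cotree (A ∪ B)

  cotree-nonempty : ∀ {S} → Cotree S → Nonempty S
  cotree-nonempty (leaf v)                  = v , x∈⁅x⁆ v
  cotree-nonempty (node {A} {B} b _ _ tA _) = let u , u∈A = cotree-nonempty tA in u , p⊆p∪q B u∈A

  monochromatic? : ∀ v (S : Subset n) b →
                   (∀ {w} → w ∈ S → adj v w ≡ b) ⊎ (∃[ w ] w ∈ S × adj v w ≡ not b)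
  monochromatic? v S b with any? (λ w → (w ∈? S) ×-dec (adj v w Bool.≟ not b))
  ... | yes found = inj₂ found
  ... | no  none  = inj₁ (λ {w} w∈S → trans (¬-not (λ e → none (w , w∈S , e))) (not-involutive b))

  -- How v attaches to A, where pairs with adjacency l count as separated and
  -- the other pairs as linked.
  data Attachment (l : Bool) (v : Fin n) (A : Subset n) : Set where
    separated : ∀ C → Nonempty C → C ⊆ A → (∀ {c w} → c ∈ C → w ∈ A → w ∉ C → adj c w ≡ l) →
                (∀ {c} → c ∈ C → adj v c ≡ l) → Attachment l v A
    linked    : (∀ {w} → w ∈ A → adj v w ≡ not l) → Attachment l v A
    mixed     : ∀ {x y} → x ∈ A → y ∈ A → adj v x ≡ not l → adj v y ≡ l → adj x y ≡ not l →
                Attachment l v A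

  -- Pairs across `A` and `B` count as separated, so a separated set of one part remains separated
  -- in the union.
  attachment-∪ : ∀ {l v A B} → (∀ {u w} → u ∈ A → w ∈ B → adj u w ≡ l) →
                 Attachment l v A → Attachment l v B → Attachment l v (A ∪ B)
  attachment-∪ {A = A} {B} sep (separated C ne C⊆A C-sep v-sep) _ =
    separated C ne (p⊆p∪q B ∘ C⊆A)
      (λ c∈C w∈A∪B w∉C → [ (λ w∈A → C-sep c∈C w∈A w∉C) , sep (C⊆A c∈C) ]′ (x∈p∪q⁻ A B w∈A∪B)) v-sep
  attachment-∪ {A = A} {B} sep _ (separated C ne C⊆B C-sep v-sep) =
    separated C ne (q⊆p∪q A B ∘ C⊆B)
      (λ {c} {w} c∈C w∈A∪B w∉C → [ (λ w∈A → trans (adj-sym c w) (sep w∈A (C⊆B c∈C)))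
                                 , (λ w∈B → C-sep c∈C w∈B w∉C) ]′ (x∈p∪q⁻ A B w∈A∪B)) v-sep
  attachment-∪ {A = A} {B} sep (mixed x∈A y∈A vx vy xy) _ =
    mixed (p⊆p∪q B x∈A) (p⊆p∪q B y∈A) vx vy xy
  attachment-∪ {A = A} {B} sep _ (mixed x∈B y∈B vx vy xy) =
    mixed (q⊆p∪q A B x∈B) (q⊆p∪q A B y∈B) vx vy xy
  attachment-∪ {A = A} {B} sep (linked vA) (linked vB) =
    linked (λ w∈A∪B → [ vA , vB ]′ (x∈p∪q⁻ A B w∈A∪B))

  -- Any two vertices of a linked join are connected by at most two links. If `v` treats some `x`
  -- and `y` differently, its attitude changes along a link between them, which gives `mixed`.
  attachment-join : ∀ {l v A B} → Nonempty A → Nonempty B →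
                    (∀ {u w} → u ∈ A → w ∈ B → adj u w ≡ not l) → Attachment l v (A ∪ B)
  attachment-join {l} {v} {A} {B} (a , a∈A) (b , b∈B) link
    with monochromatic? v (A ∪ B) l | monochromatic? v (A ∪ B) (not l)
  ... | inj₁ all-l | _ = separated (A ∪ B) (a , p⊆p∪q B a∈A) (λ w∈ → w∈) (λ _ w∈ w∉ → contradiction w∈ w∉) all-l
  ... | inj₂ _     | inj₁ all-¬l = linked all-¬l
  ... | inj₂ (x , x∈ , vx) | inj₂ (y , y∈ , vy′) = mix (x∈p∪q⁻ A B x∈) (x∈p∪q⁻ A B y∈)
    where
    link′ : ∀ {u w} → u ∈ B → w ∈ A → adj u w ≡ not l
    link′ {u} {w} u∈B w∈A = trans (adj-sym u w) (link w∈A u∈B)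
    vy : adj v y ≡ l
    vy = trans vy′ (not-involutive l)
    -- With `z` linked to both `x` and `y`, the change happens on the link `x z` or on the link
    -- `z y`, depending on how `v` meets `z`.
    via : ∀ z → z ∈ A ∪ B → adj x z ≡ not l → adj z y ≡ not l → Attachment l v (A ∪ B)
    via z z∈ xz zy with adj v z Bool.≟ l
    ... | yes vz = mixed x∈ z∈ vx vz xz
    ... | no  vz = mixed z∈ y∈ (¬-not vz) vy zy
    mix : x ∈ A ⊎ x ∈ B → y ∈ A ⊎ y ∈ B → Attachment l v (A ∪ B)
    mix (inj₁ x∈A) (inj₁ y∈A) = via b (q⊆p∪q A B b∈B) (link x∈A b∈B) (link′ b∈B y∈A)
    mix (inj₁ x∈A) (inj₂ y∈B) = mixed x∈ y∈ vx vy (link x∈A y∈B)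
    mix (inj₂ x∈B) (inj₁ y∈A) = mixed x∈ y∈ vx vy (link′ x∈B y∈A)
    mix (inj₂ x∈B) (inj₂ y∈B) = via a (p⊆p∪q B a∈A) (link′ x∈B a∈A) (link a∈A y∈B)

  -- The recursion descends only through nodes labelled `l` and stops at leaves and at nodes of the
  -- other label, that is, at the components of the graph of linked pairs.
  attach : ∀ l v {A} → Cotree A → Attachment l v A
  attach l v (leaf u) with adj v u Bool.≟ l
  ... | yes vu = separated ⁅ u ⁆ (u , x∈⁅x⁆ u) (λ w∈ → w∈) (λ _ w∈ w∉ → contradiction w∈ w∉)
                   (λ c∈ → trans (cong (adj v) (x∈⁅y⁆⇒x≡y u c∈)) vu)
  ... | no  vu = linked (λ w∈ → trans (cong (adj v) (x∈⁅y⁆⇒x≡y u w∈)) (¬-not vu))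
  attach l v (node b _ uniform tA tB) with b Bool.≟ l
  ... | yes refl = attachment-∪ uniform (attach l v tA) (attach l v tB)
  ... | no  b≢l  = attachment-join (cotree-nonempty tA) (cotree-nonempty tB)
                     (λ u∈A w∈B → trans (uniform u∈A w∈B) (¬-not b≢l))

  -- A witness that the graph induced by `S` (label `false`) or its complement (label `true`) is
  -- disconnected.
  record Split (S : Subset n) : Set where
    constructor splitting
    field
      side     : Subset n
      label    : Bool
      nonempty : Nonempty side
      proper   : side ⊂ S
      uniform  : ∀ {c w} → c ∈ side → w ∈ S → w ∉ side → adj c w ≡ label

  module _ (cograph : IsCograph G) {v : Fin n} {S S′ : Subset n} (v∈S : v ∈ S) (v∉S′ : v ∉ S′) (S′⊆S : S′ ⊆ S)
           (S⊆v+S′ : ∀ {w} → w ∈ S → w ≡ v ⊎ w ∈ S′) where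

    -- The vertex `v` lies on the far side of `C`, which keeps the split proper even when `C` is all
    -- of `S′`.
    split-separated : ∀ {l C} → Nonempty C → C ⊆ S′ → (∀ {c w} → c ∈ C → w ∈ S′ → w ∉ C → adj c w ≡ l) →
                      (∀ {c} → c ∈ C → adj v c ≡ l) → Split S
    split-separated {l} {C} ne C⊆S′ C-sep v-sep =
      splitting C l ne (S′⊆S ∘ C⊆S′ , v , v∈S , v∉S′ ∘ C⊆S′) uniform
      where
      uniform : ∀ {c w} → c ∈ C → w ∈ S → w ∉ C → adj c w ≡ l
      uniform {c} c∈C w∈S w∉C with S⊆v+S′ w∈S
      ... | inj₁ refl = trans (adj-sym c v) (v-sep c∈C)
      ... | inj₂ w∈S′ = C-sep c∈C w∈S′ w∉C

    split-linked : ∀ {b} → Nonempty S′ → (∀ {w} → w ∈ S′ → adj v w ≡ b) → Split S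
    split-linked {b} (u , u∈S′) link = splitting ⁅ v ⁆ b (v , x∈⁅x⁆ v)
      ( (λ w∈ → subst (_∈ S) (sym (x∈⁅y⁆⇒x≡y v w∈)) v∈S)
      , u , S′⊆S u∈S′ , λ u∈ → v∉S′ (subst (_∈ S′) (x∈⁅y⁆⇒x≡y v u∈) u∈S′)) uniform
      where
      uniform : ∀ {c w} → c ∈ ⁅ v ⁆ → w ∈ S → w ∉ ⁅ v ⁆ → adj c w ≡ b
      uniform c∈ w∈S w∉ with x∈⁅y⁆⇒x≡y v c∈ | S⊆v+S′ w∈S
      ... | refl | inj₁ refl = contradiction (x∈⁅x⁆ v) w∉
      ... | refl | inj₂ w∈S′ = link w∈S′

    -- Either `v` is separated from all of `B`, and `B` splits off, or it is linked to some `z` in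
    -- `B`, and the links `y x v z` form an induced P₄ in the graph or its complement. Giving `S′`
    -- by an equation lets the two children exchange roles.
    split-mixed : ∀ {l A B x y} → S′ ≡ A ∪ B → Nonempty B → (∀ {u w} → u ∈ A → w ∈ B → adj u w ≡ l) →
                  x ∈ A → y ∈ A → adj v x ≡ not l → adj v y ≡ l → adj x y ≡ not l → Split S
    split-mixed {l} {A} {B} {x} {y} refl ne sep x∈A y∈A vx vy xy with monochromatic? v B l
    ... | inj₁ v-sep = split-separated ne (q⊆p∪q A B)
            (λ {c} {w} c∈B w∈ w∉B → [ (λ w∈A → trans (adj-sym c w) (sep w∈A c∈B))
                                    , (λ w∈B → contradiction w∈B w∉B) ]′ (x∈p∪q⁻ A B w∈)) v-sep
    ... | inj₂ (z , z∈B , vz) =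
            contradiction (¬¬ (sep y∈A z∈B))
              (path₄-free cograph (not l) (trans (adj-sym y x) xy) (trans (adj-sym x v) vx) vz
                (¬¬ (trans (adj-sym y v) vy)) (¬¬ (sep x∈A z∈B)))
      where
      ¬¬ : ∀ {b} → b ≡ l → b ≡ not (not l)
      ¬¬ e = trans e (sym (not-involutive l))

    -- The inductive step for the fact that a cograph on at least two vertices or its complement is
    -- disconnected. In the `mixed` case `x` and `y` lie in the same child, since pairs across the
    -- root have adjacency `l`.
    split : Cotree S′ → Split S
    split (leaf u) = split-linked (u , x∈⁅x⁆ u) (λ w∈ → cong (adj v) (x∈⁅y⁆⇒x≡y u w∈))
    split t@(node {A} {B} l _ uniform tA tB) with attach l v t
    ... | separated C ne C⊆S′ C-sep v-sep = split-separated ne C⊆S′ C-sep v-sep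
    ... | linked link = split-linked (cotree-nonempty t) link
    ... | mixed {x} {y} x∈ y∈ vx vy xy with x∈p∪q⁻ A B x∈ | x∈p∪q⁻ A B y∈
    ...   | inj₁ x∈A | inj₁ y∈A = split-mixed refl (cotree-nonempty tB) uniform x∈A y∈A vx vy xy
    ...   | inj₂ x∈B | inj₂ y∈B = split-mixed (∪-comm A B) (cotree-nonempty tA)
              (λ {u} {w} u∈B w∈A → trans (adj-sym u w) (uniform w∈A u∈B)) x∈B y∈B vx vy xy
    ...   | inj₁ x∈A | inj₂ y∈B = contradiction xy (not-¬ (uniform x∈A y∈B))
    ...   | inj₂ x∈B | inj₁ y∈A = contradiction xy (not-¬ (trans (adj-sym x y) (uniform y∈A x∈B)))

  -- The cotree of `S` without `v` serves only to find a split of `S`; the cotrees of the two sides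
  -- are then built afresh. All three sets are proper subsets of `S`.
  cotree : IsCograph G → ∀ S → Nonempty S → Cotree S
  cotree cograph S = build (⊂-wellFounded S)
    where
    build : ∀ {S} → Acc _⊂_ S → Nonempty S → Cotree S
    build {S} (acc rec) (v , v∈S) with nonempty? (S ∩ ∁ ⁅ v ⁆)
    ... | no  empty = subst Cotree (⊆-antisym ⁅v⁆⊆S S⊆⁅v⁆) (leaf v)
      where
      ⁅v⁆⊆S : ⁅ v ⁆ ⊆ S
      ⁅v⁆⊆S w∈ = subst (_∈ S) (sym (x∈⁅y⁆⇒x≡y v w∈)) v∈S
      S⊆⁅v⁆ : S ⊆ ⁅ v ⁆
      S⊆⁅v⁆ {w} w∈S with w ∈? ⁅ v ⁆
      ... | yes w∈ = w∈
      ... | no  w∉ = contradiction (w , x∈p∩q⁺ (w∈S , x∉p⇒x∈∁p w∉)) empty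
    ... | yes ne = subst Cotree A∪B≡S (node label (λ w∈A w∈B → x∈∁p⇒x∉p (proj₂ (x∈p∩q⁻ S (∁ A) w∈B)) w∈A)
        (λ u∈A w∈B → uniform u∈A (p∩q⊆p S (∁ A) w∈B) (x∈∁p⇒x∉p (p∩q⊆q S (∁ A) w∈B)))
        (build (rec proper) nonempty)
        (build (rec B⊂S) (let w , w∈S , w∉A = proj₂ proper in w , x∈p∩q⁺ (w∈S , x∉p⇒x∈∁p w∉A))))
      where
      v∉S-v : v ∉ S ∩ ∁ ⁅ v ⁆
      v∉S-v v∈ = x∈∁p⇒x∉p (p∩q⊆q S (∁ ⁅ v ⁆) v∈) (x∈⁅x⁆ v)
      S⊆v+S-v : ∀ {w} → w ∈ S → w ≡ v ⊎ w ∈ S ∩ ∁ ⁅ v ⁆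
      S⊆v+S-v {w} w∈S with w ≟ v
      ... | yes w≡v = inj₁ w≡v
      ... | no  w≢v = inj₂ (x∈p∩q⁺ (w∈S , x∉p⇒x∈∁p (x≢y⇒x∉⁅y⁆ w≢v)))
      s : Split S
      s = split cograph v∈S v∉S-v (p∩q⊆p S (∁ ⁅ v ⁆)) S⊆v+S-v
            (build (rec (p∩q⊆p S (∁ ⁅ v ⁆) , v , v∈S , v∉S-v)) ne)
      open Split s renaming (side to A)
      B⊂S : S ∩ ∁ A ⊂ S
      B⊂S = p∩q⊆p S (∁ A) , let c , c∈A = nonempty in
        c , proj₁ proper c∈A , λ c∈B → x∈∁p⇒x∉p (p∩q⊆q S (∁ A) c∈B) c∈A
      A∪B≡S : A ∪ (S ∩ ∁ A) ≡ S
      A∪B≡S = ⊆-antisym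
        (λ w∈ → [ proj₁ proper , p∩q⊆p S (∁ A) ]′ (x∈p∪q⁻ A (S ∩ ∁ A) w∈))
        (λ {w} w∈S → x∈p∪q⁺ (case-∈ w w∈S))
        where
        case-∈ : ∀ w → w ∈ S → w ∈ A ⊎ w ∈ S ∩ ∁ A
        case-∈ w w∈S with w ∈? A
        ... | yes w∈A = inj₁ w∈A
        ... | no  w∉A = inj₂ (x∈p∩q⁺ (w∈S , x∉p⇒x∈∁p w∉A))

-- Colouring cographs

toParity : Bool → Parity
toParity false = 0ℙ
toParity true  = 1ℙ

toParity-injective : ∀ {b c} → toParity b ≡ toParity c → b ≡ c
toParity-injective {false} {false} _ = refl
toParity-injective {true}  {true}  _ = refl

parity-∣∣ : (S : Subset n) → parity ∣ S ∣ ≡ toParity (sum (lookup S))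
parity-∣∣ []          = refl
parity-∣∣ (false ∷ S) = parity-∣∣ S
parity-∣∣ (true ∷ S)  = begin
  parity (suc ∣ S ∣)                   ≡⟨ ⁻¹-selfInverse (suc-homo-⁻¹ ∣ S ∣) ⟨
  parity ∣ S ∣ ⁻¹                      ≡⟨ cong _⁻¹ (parity-∣∣ S) ⟩
  toParity (sum (lookup S)) ⁻¹         ≡⟨ toParity-not (sum (lookup S)) ⟩
  toParity (not (sum (lookup S)))      ∎
  where
  toParity-not : ∀ b → toParity b ⁻¹ ≡ toParity (not b)
  toParity-not false = refl
  toParity-not true  = refl

lookup-∪ : (A B : Subset n) → ∀ w → lookup (A ∪ B) w ≡ lookup A w ∨ lookup B w
lookup-∪ A B w = lookup-zipWith _∨_ w A B

lookup-disjoint : {A B : Subset n} → (∀ {w} → w ∈ A → w ∉ B) → ∀ w → lookup A w ≡ true → lookup B w ≡ false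
lookup-disjoint {A = A} {B} disjoint w Aw = ¬-not (λ Bw → disjoint (lookup⇒[]= w A Aw) (lookup⇒[]= w B Bw))

module _ (G : Graph n) (even : EvenComponents G) where
  open Graph G
  open Adjacency G

  Closed : Subset n → Set
  Closed S = ∀ {u w} → u ∈ S → u ~ w → w ∈ S

  closed-star : ∀ {S} → Closed S → ∀ {u w} → u ∈ S → Star _~_ u w → w ∈ S
  closed-star closed u∈S ε        = u∈S
  closed-star closed u∈S (e ◅ es) = closed-star closed (closed u∈S e) es

  component-even : ∀ {S v} → Closed S → v ∈ S → (∀ {w} → w ∈ S → Star _~_ v w) → sum (lookup S) ≡ false
  component-even {S} {v} closed v∈S connected = toParity-injective
    (trans (sym (parity-∣∣ S)) (even S (v , λ w → mk⇔ connected (closed-star closed v∈S))))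

  -- Closedness passes to the parts of a disjoint union. A closed join is connected, hence a
  -- component of even order, and is coloured without recursion. A closed leaf would be a component
  -- of order one.
  colourable : ∀ {S} → Cotree G S → Closed S → OddColourable₃ (lookup S)
  colourable (leaf v) closed =
    contradiction (trans (sym (component-even closed (x∈⁅x⁆ v) connected)) sum≡true) λ ()
    where
    connected : ∀ {w} → w ∈ ⁅ v ⁆ → Star _~_ v w
    connected w∈ = subst (Star _~_ v) (sym (x∈⁅y⁆⇒x≡y v w∈)) ε
    sum≡true : sum (lookup ⁅ v ⁆) ≡ true
    sum≡true = toParity-injective (trans (sym (parity-∣∣ ⁅ v ⁆)) (cong parity (∣⁅x⁆∣≡1 v)))
  colourable (node {A} {B} false disjoint uniform tA tB) closed =
    disjoint-union-colouring (lookup-∪ A B) (lookup-disjoint disjoint)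
      (λ u w Au Bw → uniform (lookup⇒[]= u A Au) (lookup⇒[]= w B Bw))
      (colourable tA closed-A) (colourable tB closed-B)
    where
    closed-A : Closed A
    closed-A {u} {w} u∈A u~w with x∈p∪q⁻ A B (closed (p⊆p∪q B u∈A) u~w)
    ... | inj₁ w∈A = w∈A
    ... | inj₂ w∈B = contradiction (trans (sym (dec-true (u ~? w) u~w)) (uniform u∈A w∈B)) λ ()
    closed-B : Closed B
    closed-B {u} {w} u∈B u~w with x∈p∪q⁻ A B (closed (q⊆p∪q A B u∈B) u~w)
    ... | inj₁ w∈A = contradiction (trans (sym (dec-true (w ~? u) (~-sym u~w))) (uniform w∈A u∈B)) λ ()
    ... | inj₂ w∈B = w∈B
  colourable (node {A} {B} true disjoint uniform tA tB) closed =
    join-colouring (lookup-∪ A B) (lookup-disjoint disjoint)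
      (λ u w Au Bw → uniform (lookup⇒[]= u A Au) (lookup⇒[]= w B Bw))
      ([]=⇒lookup p∈A) ([]=⇒lookup q∈B)
      (component-even closed (p⊆p∪q B p∈A) connected)
    where
    p = proj₁ (cotree-nonempty G tA)
    p∈A = proj₂ (cotree-nonempty G tA)
    q = proj₁ (cotree-nonempty G tB)
    q∈B = proj₂ (cotree-nonempty G tB)
    edge : ∀ {u w} → u ∈ A → w ∈ B → u ~ w
    edge {u} {w} u∈A w∈B = does-true (u ~? w) (uniform u∈A w∈B)
    connected : ∀ {w} → w ∈ A ∪ B → Star _~_ p w
    connected w∈ with x∈p∪q⁻ A B w∈
    ... | inj₁ w∈A = edge p∈A q∈B ◅ ~-sym (edge w∈A q∈B) ◅ ε
    ... | inj₂ w∈B = edge p∈A w∈B ◅ ε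

-- The odd chromatic number

any-vec? : {P : Vec (Fin k) n → Set} → (∀ c → Dec (P c)) → Dec (∃[ c ] P c)
any-vec? {n = zero}  P? = map′ ([] ,_) (λ { ([] , p) → p }) (P? [])
any-vec? {n = suc n} P? = map′ (λ { (i , c , p) → i ∷ c , p }) (λ { (i ∷ c , p) → i , c , p })
  (any? (λ i → any-vec? (λ c → P? (i ∷ c))))

least : {P : ℕ → Set} → (∀ m → Dec (P m)) → ∀ m → P m → ∃[ l ] l ≤ m × P l × (∀ j → P j → l ≤ j)
least P? zero    p = 0 , z≤n , p , λ _ _ → z≤n
least P? (suc m) p with P? 0
... | yes p₀ = 0 , z≤n , p₀ , λ _ _ → z≤n
... | no ¬p₀ with least (P? ∘ suc) m p
...   | l , l≤m , q , minimal = suc l , s≤s l≤m , q , λ where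
        zero    p₀ → contradiction p₀ ¬p₀
        (suc j) pⱼ → s≤s (minimal j pⱼ)

module _ (G : Graph n) where
  open Graph G using (neighbours; degreeIn)
  open Adjacency G

  TotalOddColouring : (Fin n → Fin k) → Set
  TotalOddColouring f = ∀ v → degree (λ w → δ (f w) (f v)) v ≡ true

  TotalOddColouring-cong : (f : Fin n → Fin k) (g : Fin n → Fin l) → (∀ u v → δ (f u) (f v) ≡ δ (g u) (g v)) →
                           TotalOddColouring f → TotalOddColouring g
  TotalOddColouring-cong f g eq odd v = trans (sum-cong-≗ (λ w → cong (adj v w ∧_) (sym (eq w v)))) (odd v)

  -- A colouring is stored as a vector so that exhaustive search decides its existence.
  OddColourable : ℕ → Set
  OddColourable k = ∃[ c ] TotalOddColouring {k} (lookup c)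

  oddColourable? : ∀ k → Dec (OddColourable k)
  oddColourable? k = any-vec? (λ c → all? (λ v → degree (λ w → δ (lookup c w) (lookup c v)) v Bool.≟ true))

  colouring⇒colourable : {f : Fin n → Fin k} → TotalOddColouring f → OddColourable k
  colouring⇒colourable {f = f} odd = tabulate f , TotalOddColouring-cong f (lookup (tabulate f))
    (λ u v → sym (cong₂ δ (lookup∘tabulate f u) (lookup∘tabulate f v))) odd

  parity-degreeIn : ∀ S v → parity (degreeIn S v) ≡ toParity (degree (lookup S) v)
  parity-degreeIn S v = trans (parity-∣∣ (neighbours v ∩ S)) (cong toParity (sum-cong-≗ (λ w →
    trans (lookup-zipWith _∧_ w (neighbours v) S) (cong (_∧ lookup S w) (lookup∘tabulate (adj v) w)))))

  partition⇒colourable : OddPartition G k → OddColourable k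
  partition⇒colourable P = colouring⇒colourable {f = f} odd-f
    where
    open OddPartition P
    f : Fin n → Fin _
    f v = proj₁ (covering v)
    lookup-part : ∀ i w → lookup (part i) w ≡ δ (f w) i
    lookup-part i w with f w ≟ i
    ... | yes refl = []=⇒lookup (proj₂ (covering w))
    ... | no  fw≢i = ¬-not (λ e → fw≢i (disjoint _ _ w (proj₂ (covering w)) (lookup⇒[]= w (part i) e)))
    odd-f : TotalOddColouring f
    odd-f v = trans (sum-cong-≗ (λ w → cong (adj v w ∧_) (sym (lookup-part (f v) w))))
      (toParity-injective (trans (sym (parity-degreeIn (part (f v)) v)) (odd (f v) v (proj₂ (covering v)))))

  colouring⇒partition : {f : Fin n → Fin k} → (∀ i → ∃[ v ] f v ≡ i) → TotalOddColouring f → OddPartition G k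
  colouring⇒partition {k} {f} surjective odd = record
    { part     = part
    ; nonempty = λ i → let v , fv≡i = surjective i in v , ∈-part fv≡i
    ; disjoint = λ i j v v∈i v∈j → trans (sym (part-∈ v∈i)) (part-∈ v∈j)
    ; covering = λ v → f v , ∈-part refl
    ; odd      = odd-part
    }
    where
    part : Fin k → Subset n
    part i = tabulate (λ w → δ (f w) i)
    ∈-part : ∀ {v i} → f v ≡ i → v ∈ part i
    ∈-part {v} {i} fv≡i = lookup⇒[]= v (part i) (trans (lookup∘tabulate _ v) (dec-true (f v ≟ i) fv≡i))
    part-∈ : ∀ {v i} → v ∈ part i → f v ≡ i
    part-∈ {v} {i} v∈ = does-true (f v ≟ i) (trans (sym (lookup∘tabulate _ v)) ([]=⇒lookup v∈))
    odd-part : ∀ i → IsOddInduced G (part i)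
    odd-part i v v∈ with part-∈ v∈
    ... | refl = trans (parity-degreeIn (part i) v) (cong toParity
      (trans (sum-cong-≗ (λ w → cong (adj v w ∧_) (lookup∘tabulate _ w))) (odd v)))

  unused-colour : {f : Fin n → Fin (suc k)} → TotalOddColouring f → ∀ i → (∀ v → f v ≢ i) → OddColourable k
  unused-colour {k} {f} odd i unused = colouring⇒colourable {f = g} (TotalOddColouring-cong f g same odd)
    where
    g : Fin n → Fin k
    g v = punchOut (unused v ∘ sym)
    same : ∀ u v → δ (f u) (f v) ≡ δ (g u) (g v)
    same u v = does-⇔ (mk⇔ (punchOut-cong i) (punchOut-injective (unused u ∘ sym) (unused v ∘ sym)))
                      (f u ≟ f v) (g u ≟ g v)

  least-colourable⇒partition : OddColourable k → (∀ j → OddColourable j → k ≤ j) → OddPartition G k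
  least-colourable⇒partition (c , odd) minimal =
    colouring⇒partition {f = lookup c} (used {f = lookup c} minimal odd) odd
    where
    used : ∀ {k} {f : Fin n → Fin k} → (∀ j → OddColourable j → k ≤ j) → TotalOddColouring f → ∀ i → ∃[ v ] f v ≡ i
    used {suc k} {f} minimal odd i with any? (λ v → f v ≟ i)
    ... | yes v    = v
    ... | no  none = contradiction (minimal k (unused-colour {f = f} odd i (λ v e → none (v , e)))) 1+n≰n

  -- The relation `χodd G ≤ k` asks for the exact minimum, which decidability of `OddColourable`
  -- makes available.
  colourable⇒χodd≤ : OddColourable k → χodd G ≤ k
  colourable⇒χodd≤ {k} coloured with least oddColourable? k coloured
  ... | l , l≤k , coloured-l , minimal =
    l , (least-colourable⇒partition coloured-l minimal , λ m P → minimal m (partition⇒colourable P)) , l≤k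

  χodd≤⇒χodd≡ : χodd G ≤ k → (∀ j → OddColourable j → k ≤ j) → χodd G ≡ k
  χodd≤⇒χodd≡ (l , (P , minimal) , l≤k) bound =
    subst (χodd G ≡_) (≤-antisym l≤k (bound l (partition⇒colourable P))) (P , minimal)

cograph-χodd≤3 : (G : Graph n) → IsCograph G → EvenComponents G → χodd G ≤ 3
cograph-χodd≤3 {n} G cograph even = colourable⇒χodd≤ G (colouring⇒colourable G {f = proj₁ total} (proj₂ total))
  where
  open Adjacency G
  total : ∃[ f ] TotalOddColouring G {3} f
  total with nonempty? (⊤ {n})
  -- A cotree has at least one leaf, so the graph without vertices is treated apart, with a vacuous
  -- colouring.
  ... | no  empty = (λ _ → 0F) , λ v → contradiction (v , ∈⊤) empty
  ... | yes ne with colourable G even (cotree G cograph ⊤ ne) (λ _ _ → ∈⊤)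
  ...   | f , odd = f , λ v → trans
          (sum-cong-≗ (λ w → cong (λ b → adj v w ∧ (b ∧ δ (f w) (f v))) (sym (lookup-replicate w true))))
          (odd v (lookup-replicate v true))

-- Tightness: the octahedron

commonNeighbours⇒evenComponents : (G : Graph n) → parity n ≡ 0ℙ →
  (∀ v w → ∃[ u ] Graph._~_ G v u × Graph._~_ G u w) → EvenComponents G
commonNeighbours⇒evenComponents {n} G n-even common C (v , component) =
  trans (cong parity (trans (cong ∣_∣ C≡⊤) (∣⊤∣≡n n))) n-even
  where
  C≡⊤ : C ≡ ⊤
  C≡⊤ = ⊆-antisym ⊆⊤ λ {w} _ →
    -- Two steps lead from `v` to any vertex, so the only component is the whole vertex set.
    let u , v~u , u~w = common v w in Equivalence.from (component w) (v~u ◅ u~w ◅ ε)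

completeMultipartite : (Fin n → Fin k) → Graph n
completeMultipartite block = record
  { _~_      = λ u w → block u ≢ block w
  ; _~?_     = λ u w → ¬? (block u ≟ block w)
  ; ~-sym    = λ u≁w → u≁w ∘ sym
  ; ~-irrefl = λ { refl u≁u → u≁u refl }
  }

-- Non-adjacency is transitive in a complete multipartite graph, but not in P₄.
completeMultipartite-cograph : (block : Fin n → Fin k) → IsCograph (completeMultipartite block)
completeMultipartite-cograph block (f , _ , induced) =
  Equivalence.to (induced 2F 3F) (inj₁ refl)
    (trans (sym (same 0F 2F λ { (inj₁ ()) ; (inj₂ ()) })) (same 0F 3F λ { (inj₁ ()) ; (inj₂ ()) }))
  where
  same : ∀ i j → ¬ Graph._~_ (path 4) i j → block (f i) ≡ block (f j)
  same i j i≁j = decidable-stable (block (f i) ≟ block (f j)) (i≁j ∘ Equivalence.from (induced i j))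

K₂₂₂ : Graph 6
K₂₂₂ = completeMultipartite (lookup (0F ∷ 0F ∷ 1F ∷ 1F ∷ 2F ∷ 2F ∷ ([] {A = Fin 3})))

K₂₂₂-cograph : IsCograph K₂₂₂
K₂₂₂-cograph = completeMultipartite-cograph (lookup (0F ∷ 0F ∷ 1F ∷ 1F ∷ 2F ∷ 2F ∷ []))

K₂₂₂-even : EvenComponents K₂₂₂
K₂₂₂-even = commonNeighbours⇒evenComponents K₂₂₂ refl
  (from-yes (all? λ v → all? λ w → any? λ u → (v ~? u) ×-dec (u ~? w)))
  where open Graph K₂₂₂

-- Fewer than three colours are refuted by exhaustive search. By hand: the graph is 4-regular, so
-- one class fails; odd classes have even order, so two classes would be an edge and its complement,
-- in which the block missed by the edge has degree 2.
K₂₂₂-colours : ∀ k → OddColourable K₂₂₂ k → 3 ≤ k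
K₂₂₂-colours 0 coloured = contradiction coloured (from-no (oddColourable? K₂₂₂ 0))
K₂₂₂-colours 1 coloured = contradiction coloured (from-no (oddColourable? K₂₂₂ 1))
K₂₂₂-colours 2 coloured = contradiction coloured (from-no (oddColourable? K₂₂₂ 2))
K₂₂₂-colours (suc (suc (suc k))) _ = s≤s (s≤s (s≤s z≤n))

corollary1 : (∀ (n : ℕ) (G : Graph n) → IsCograph G → EvenComponents G → χodd G ≤ 3)
    × (Σ[ n ∈ ℕ ] Σ[ G ∈ Graph n ] (IsCograph G × EvenComponents G × (χodd G ≡ 3)))
corollary1 = (λ n G → cograph-χodd≤3 G) , 6 , K₂₂₂ , K₂₂₂-cograph , K₂₂₂-even ,
  χodd≤⇒χodd≡ K₂₂₂ (cograph-χodd≤3 K₂₂₂ K₂₂₂-cograph K₂₂₂-even) K₂₂₂-colours
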